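{- Let $\mathcal X=\{1,\dots,n\}$ and $\mathcal Y=\{1,\dots,m\}$. There is a one-to-one correspondence (bijection) between $\mathcal A^\sim_{n,m}$, the set of $(n+m)\times(m+n)$ $\epsilon$-assignment matrices up to equivalence, and the set of injective functions from a subset of $\mathcal X$ to $\mathcal Y$ (the empty function included).
   Context: An $\epsilon$-assignment matrix is an $(n+m)\times(m+n)$ permutation matrix (entries in $\{0,1\}$, every row and column summing to $1$), written in block form $$\mathbf X=\begin{pmatrix}\mathbf X^{\mathrm{sub}}&\mathbf X^{\mathrm{rem}}\\ \mathbf X^{\mathrm{ins}}&\mathbf X^{\epsilon}\end{pmatrix},$$ with $\mathbf X^{\mathrm{sub}}\in\{0,1\}^{n\times m}$, $\mathbf X^{\mathrm{rem}}\in\{0,1\}^{n\times n}$, $\mathbf X^{\mathrm{ins}}\in\{0,1\}^{m\times m}$, $\mathbf X^{\epsilon}\in\{0,1\}^{m\times n}$, such that all off-diagonal entries of $\mathbf X^{\mathrm{rem}}$ and of $\mathbf X^{\mathrm{ins}}$ are $0$. Two $\epsilon$-assignment matrices $\mathbf X_1,\mathbf X_2$ are equivalent iff $\mathbf X_1^{\mathrm{sub}}=\mathbf X_2^{\mathrm{sub}}$, $\mathbf X_1^{\mathrm{rem}}=\mathbf X_2^{\mathrm{rem}}$ and $\mathbf X_1^{\mathrm{ins}}=\mathbf X_2^{\mathrm{ins}}$. $\mathcal A_{n,m}^\sim$ is the set of equivalence classes. -}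

module Defs where

open import Data.Fin.Base using (Fin; _↑ˡ_; _↑ʳ_)
open import Data.Fin.Subset using (Subset; _∈_)
open import Data.Nat.Base using (ℕ; _+_)
open import Data.Nat.Properties using (+-0-commutativeMonoid)
open import Data.Product.Base using (∃; _,_)
open import Data.Sum.Base using (_⊎_)
open import Data.Vec.Functional using (Vector; transpose)
open import Data.Vec.Properties.WithK using ([]=-irrelevant)
open import Function.Bundles using (_↣_; module Injection)
open import Level using (0ℓ)
open import Relation.Binary.Bundles using (Setoid)
open import Relation.Binary.PropositionalEquality
  using (_≡_; _≢_; refl; sym; trans; cong; subst)

open import Algebra.Properties.CommutativeMonoid.Sum +-0-commutativeMonoid
  using (sum)

Matrix : ℕ → ℕ → Set
Matrix r c = Vector (Vector ℕ c) r

infix 4 _≋_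

_≋_ : ∀ {r c} → Matrix r c → Matrix r c → Set
X ≋ Y = ∀ i j → X i j ≡ Y i j

record IsPermutationMatrix {r c : ℕ} (X : Matrix r c) : Set where
  field
    zero-one : ∀ i j → X i j ≡ 0 ⊎ X i j ≡ 1
    row-sum  : ∀ i → sum (X i) ≡ 1
    col-sum  : ∀ j → sum (transpose X j) ≡ 1

OffDiagonalZero : ∀ {k} → Matrix k k → Set
OffDiagonalZero X = ∀ i j → i ≢ j → X i j ≡ 0

-- Rows split as n + m, columns as m + n:
--
--   ( sub  rem )
--   ( ins  eps )

module Blocks {n m : ℕ} (X : Matrix (n + m) (m + n)) where

  sub : Matrix n m
  sub i j = X (i ↑ˡ m) (j ↑ˡ n)

  rem : Matrix n n
  rem i j = X (i ↑ˡ m) (m ↑ʳ j)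

  ins : Matrix m m
  ins i j = X (n ↑ʳ i) (j ↑ˡ n)

  eps : Matrix m n
  eps i j = X (n ↑ʳ i) (m ↑ʳ j)

record εAssignmentMatrix (n m : ℕ) : Set where
  field
    matrix        : Matrix (n + m) (m + n)
    isPermutation : IsPermutationMatrix matrix

  open Blocks {n} {m} matrix public

  field
    rem-diagonal : OffDiagonalZero rem
    ins-diagonal : OffDiagonalZero ins

infix 4 _∼_

-- The block eps is deliberately not compared.
record _∼_ {n m : ℕ} (X Y : εAssignmentMatrix n m) : Set where
  private
    module X = εAssignmentMatrix X
    module Y = εAssignmentMatrix Y
  field
    sub-≋ : X.sub ≋ Y.sub
    rem-≋ : X.rem ≋ Y.rem
    ins-≋ : X.ins ≋ Y.ins

∼-refl : ∀ {n m} {X : εAssignmentMatrix n m} → X ∼ X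
∼-refl = record
  { sub-≋ = λ _ _ → refl
  ; rem-≋ = λ _ _ → refl
  ; ins-≋ = λ _ _ → refl
  }

∼-sym : ∀ {n m} {X Y : εAssignmentMatrix n m} → X ∼ Y → Y ∼ X
∼-sym p = record
  { sub-≋ = λ i j → sym (_∼_.sub-≋ p i j)
  ; rem-≋ = λ i j → sym (_∼_.rem-≋ p i j)
  ; ins-≋ = λ i j → sym (_∼_.ins-≋ p i j)
  }

∼-trans : ∀ {n m} {X Y Z : εAssignmentMatrix n m} → X ∼ Y → Y ∼ Z → X ∼ Z
∼-trans p q = record
  { sub-≋ = λ i j → trans (_∼_.sub-≋ p i j) (_∼_.sub-≋ q i j)
  ; rem-≋ = λ i j → trans (_∼_.rem-≋ p i j) (_∼_.rem-≋ q i j)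
  ; ins-≋ = λ i j → trans (_∼_.ins-≋ p i j) (_∼_.ins-≋ q i j)
  }

-- The quotient by _∼_, as a setoid.
𝒜∼ : ℕ → ℕ → Setoid 0ℓ 0ℓ
𝒜∼ n m = record
  { Carrier       = εAssignmentMatrix n m
  ; _≈_           = _∼_
  ; isEquivalence = record
    { refl  = ∼-refl
    ; sym   = ∼-sym
    ; trans = ∼-trans
    }
  }

-- Membership i ∈ S is proof-irrelevant ([]=-irrelevant), so the pairs
-- below are exactly the elements of S, compared by their first component.
record PartialInjection (n m : ℕ) : Set where
  field
    domain    : Subset n
    injection : (∃ λ i → i ∈ domain) ↣ Fin m

  apply : ∀ i → i ∈ domain → Fin m
  apply i i∈ = Injection.to injection (i , i∈)

infix 4 _≐_

-- Equality of functions: same domain and same values.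
record _≐_ {n m : ℕ} (f g : PartialInjection n m) : Set where
  private
    module f = PartialInjection f
    module g = PartialInjection g
  field
    domain-≡ : f.domain ≡ g.domain
    apply-≡  : ∀ i (p : i ∈ f.domain) (q : i ∈ g.domain) →
               f.apply i p ≡ g.apply i q

≐-refl : ∀ {n m} {f : PartialInjection n m} → f ≐ f
≐-refl {f = f} = record
  { domain-≡ = refl
  ; apply-≡  = λ i p q →
      cong (PartialInjection.apply f i) ([]=-irrelevant p q)
  }

≐-sym : ∀ {n m} {f g : PartialInjection n m} → f ≐ g → g ≐ f
≐-sym e = record
  { domain-≡ = sym (_≐_.domain-≡ e)
  ; apply-≡  = λ i p q → sym (_≐_.apply-≡ e i q p)
  }

≐-trans : ∀ {n m} {f g h : PartialInjection n m} → f ≐ g → g ≐ h → f ≐ h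
≐-trans d e = record
  { domain-≡ = trans (_≐_.domain-≡ d) (_≐_.domain-≡ e)
  ; apply-≡  = λ i p r →
      let q = subst (i ∈_) (_≐_.domain-≡ d) p
      in trans (_≐_.apply-≡ d i p q) (_≐_.apply-≡ e i q r)
  }

PartialInjections : ℕ → ℕ → Setoid 0ℓ 0ℓ
PartialInjections n m = record
  { Carrier       = PartialInjection n m
  ; _≈_           = _≐_
  ; isEquivalence = record
    { refl  = ≐-refl
    ; sym   = ≐-sym
    ; trans = ≐-trans
    }
  }

{-# OPTIONS --safe #-}

-- The block sub determines the class of X: the off-diagonal entries of rem and
-- ins vanish, so their diagonal entries are forced by the row and column sums.
-- Reading sub as the graph of a relation between rows and columns, the sums
-- say exactly that this relation is a partial injection. Conversely, a graph
-- matrix S is completed to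
--
--   ( S   D  )
--   ( D'  Sᵀ )
--
-- where the diagonal matrices D and D' hold the deficits 1 - (sum of row i)
-- and 1 - (sum of column j) of S.

module Submission where

open import Defs
import Data.Nat.Properties as ℕ
open import Algebra.Properties.CommutativeMonoid.Sum
  ℕ.+-0-commutativeMonoid
  using (sum; sum-cong-≗; sum-replicate-zero)
open import Data.Bool.Base using (true)
open import Data.Fin.Base using (Fin; zero; suc; _↑ˡ_; _↑ʳ_; splitAt)
open import Data.Fin.Properties
  using (_≟_; any?; suc-injective; splitAt-↑ˡ; splitAt-↑ʳ)
open import Data.Fin.Subset using (Subset; _∈_)
open import Data.Fin.Subset.Properties using (_∈?_; ⊆-antisym)
open import Data.Nat.Base using (ℕ; zero; suc; _+_; _∸_; _≤_; z≤n; s≤s)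
open import Data.Product.Base using (Σ; ∃; _,_; proj₁; proj₂)
open import Data.Sum.Base using (_⊎_; inj₁; inj₂)
open import Data.Vec.Base using (tabulate)
open import Data.Vec.Functional using (Vector; transpose)
open import Data.Vec.Properties
  using ([]=⇒lookup; lookup⇒[]=; lookup∘tabulate)
open import Data.Vec.Properties.WithK using ([]=-irrelevant)
open import Function.Base using (_∘_)
open import Function.Bundles
  using (Bijection; Injection; _⇔_; mk⇔; mk↣; module Equivalence)
open import Relation.Binary.PropositionalEquality
open import Relation.Nullary.Decidable
  using (Dec; yes; no; does; map′; dec-true)
open import Relation.Nullary.Negation using (contradiction)
open import Relation.Unary using (Decidable)

open Equivalence using (to; from)

-- Sums of vectors of natural numbers and zero-one entries.

ZeroOne : ℕ → Set
ZeroOne k = k ≡ 0 ⊎ k ≡ 1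

AtMostOne : ∀ {k} → (Fin k → Set) → Set
AtMostOne P = ∀ {i j} → P i → P j → i ≡ j

sum-++ : ∀ m {n} (v : Vector ℕ (m + n)) →
         sum v ≡ sum (λ i → v (i ↑ˡ n)) + sum (λ j → v (m ↑ʳ j))
sum-++ zero    v = refl
sum-++ (suc m) v = trans (cong (v zero +_) (sum-++ m (v ∘ suc)))
                         (sym (ℕ.+-assoc (v zero) _ _))

sum-single : ∀ {k} (v : Vector ℕ k) i → (∀ j → i ≢ j → v j ≡ 0) → sum v ≡ v i
sum-single {suc k} v zero v≡0 = begin
  v zero + sum (v ∘ suc)         ≡⟨ cong (v zero +_) (sum-cong-≗ λ j → v≡0 (suc j) λ ()) ⟩
  v zero + sum {k} (λ _ → 0)     ≡⟨ cong (v zero +_) (sum-replicate-zero k) ⟩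
  v zero + 0                     ≡⟨ ℕ.+-identityʳ (v zero) ⟩
  v zero                         ∎
  where open ≡-Reasoning
sum-single v (suc i) v≡0 =
  cong₂ _+_ (v≡0 zero λ ())
            (sum-single (v ∘ suc) i λ j i≢j → v≡0 (suc j) (i≢j ∘ suc-injective))

entry≤sum : ∀ {k} (v : Vector ℕ k) i → v i ≤ sum v
entry≤sum v zero    = ℕ.m≤m+n (v zero) _
entry≤sum v (suc i) = ℕ.≤-trans (entry≤sum (v ∘ suc) i) (ℕ.m≤n+m _ (v zero))

-- Two ones at distinct positions would already contribute 2 to the sum.
sum≤1⇒atMostOne : ∀ {k} (v : Vector ℕ k) → sum v ≤ 1 → AtMostOne (λ i → v i ≡ 1)
sum≤1⇒atMostOne v ≤1 {zero}  {zero}  p q = refl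
sum≤1⇒atMostOne v ≤1 {zero}  {suc j} p q = contradiction
  (ℕ.≤-trans (ℕ.+-mono-≤ (ℕ.≤-reflexive (sym p))
    (subst (_≤ sum (v ∘ suc)) q (entry≤sum (v ∘ suc) j))) ≤1) λ { (s≤s ()) }
sum≤1⇒atMostOne v ≤1 {suc i} {zero}  p q = sym (sum≤1⇒atMostOne v ≤1 q p)
sum≤1⇒atMostOne v ≤1 {suc i} {suc j} p q =
  cong suc (sum≤1⇒atMostOne (v ∘ suc) (ℕ.≤-trans (ℕ.m≤n+m _ (v zero)) ≤1) p q)

-- If the head is 0, the tail carries the whole sum. If it is 1, uniqueness forces every other entry
-- to 0, so the sum collapses to the head.
atMostOne⇒sum≤1 : ∀ {k} (v : Vector ℕ k) → (∀ i → ZeroOne (v i)) →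
                  AtMostOne (λ i → v i ≡ 1) → sum v ≤ 1
atMostOne⇒sum≤1 {zero}  v v01 unique = z≤n
atMostOne⇒sum≤1 {suc k} v v01 unique with v01 zero
... | inj₁ v₀≡0 = subst (λ x → x + sum (v ∘ suc) ≤ 1) (sym v₀≡0)
  (atMostOne⇒sum≤1 (v ∘ suc) (v01 ∘ suc) λ p q → suc-injective (unique p q))
... | inj₂ v₀≡1 = ℕ.≤-reflexive (trans (sum-single v zero others) v₀≡1)
  where
  others : ∀ j → zero ≢ j → v j ≡ 0
  others j 0≢j with v01 j
  ... | inj₁ vⱼ≡0 = vⱼ≡0
  ... | inj₂ vⱼ≡1 = contradiction (unique v₀≡1 vⱼ≡1) 0≢j

-- Reduces equality of zero-one matrices to comparing the positions of their ones.
zeroOne-≡ : ∀ {k l} → ZeroOne k → ZeroOne l → (k ≡ 1 ⇔ l ≡ 1) → k ≡ l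
zeroOne-≡ (inj₁ k≡0) (inj₁ l≡0) _   = trans k≡0 (sym l≡0)
zeroOne-≡ (inj₁ _)   (inj₂ l≡1) iff = trans (from iff l≡1) (sym l≡1)
zeroOne-≡ (inj₂ k≡1) _          iff = trans k≡1 (sym (to iff k≡1))

-- Decidable predicates as numbers and as subsets.

indicator : ∀ {P : Set} → Dec P → ℕ
indicator (yes _) = 1
indicator (no  _) = 0

indicator-zeroOne : ∀ {P : Set} (P? : Dec P) → ZeroOne (indicator P?)
indicator-zeroOne (yes _) = inj₂ refl
indicator-zeroOne (no  _) = inj₁ refl

indicator≡1 : ∀ {P : Set} (P? : Dec P) → indicator P? ≡ 1 ⇔ P
indicator≡1 (yes p) = mk⇔ (λ _ → p) (λ _ → refl)
indicator≡1 (no ¬p) = mk⇔ (λ ()) (λ p → contradiction p ¬p)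

comprehension : ∀ {k} {P : Fin k → Set} → Decidable P → Subset k
comprehension P? = tabulate (does ∘ P?)

∈-comprehension : ∀ {k} {P : Fin k → Set} (P? : Decidable P) {i} →
                  i ∈ comprehension P? ⇔ P i
∈-comprehension {P = P} P? {i} = mk⇔
  (λ i∈ → does⇒ (P? i) (trans (sym (lookup∘tabulate _ i)) ([]=⇒lookup i∈)))
  (λ p → lookup⇒[]= i _ (trans (lookup∘tabulate _ i) (dec-true (P? i) p)))
  where
  does⇒ : ∀ {A : Set} (A? : Dec A) → does A? ≡ true → A
  does⇒ (yes a) _ = a

-- Graphs of partial injections.

module _ {n m : ℕ} where

  -- The membership proof is packed into the relation, so graphs of functions with different domains
  -- live on the same index sets and compare without transport.
  Graph : PartialInjection n m → Fin n → Fin m → Set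
  Graph f i j = Σ (i ∈ domain) λ i∈ → apply i i∈ ≡ j
    where open PartialInjection f

  module _ (f : PartialInjection n m) where
    open PartialInjection f

    graph? : ∀ i j → Dec (Graph f i j)
    graph? i j with i ∈? domain
    ... | no  i∉ = no (i∉ ∘ proj₁)
    ... | yes i∈ = map′ (i∈ ,_)
      -- A given graph witness may carry another membership proof than the one found by `∈?`;
      -- irrelevance identifies their values.
      (λ (i∈′ , eq) → trans (cong (apply i) ([]=-irrelevant i∈ i∈′)) eq)
      (apply i i∈ ≟ j)

    graph-functional : ∀ {i} → AtMostOne (Graph f i)
    graph-functional {i} (p , p↦) (q , q↦) =
      trans (sym p↦) (trans (cong (apply i) ([]=-irrelevant p q)) q↦)

    graph-injective : ∀ {j} → AtMostOne (λ i → Graph f i j)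
    graph-injective (p , p↦) (q , q↦) =
      cong proj₁ (Injection.injective injection (trans p↦ (sym q↦)))

  ≐⇒graph : ∀ {f g : PartialInjection n m} → f ≐ g →
            ∀ {i j} → Graph f i j → Graph g i j
  ≐⇒graph e {i} (p , p↦) = q , trans (sym (apply-≡ i p q)) p↦
    where
    open _≐_ e
    q = subst (i ∈_) domain-≡ p

  -- The domain is the projection of the graph, and functionality of the graph pins down the values.
  graph⇒≐ : ∀ {f g : PartialInjection n m} →
            (∀ {i j} → Graph f i j ⇔ Graph g i j) → f ≐ g
  graph⇒≐ {f} {g} e = record
    { domain-≡ = ⊆-antisym (λ p → proj₁ (to e (p , refl)))
                           (λ q → proj₁ (from e (q , refl)))
    ; apply-≡  = λ i p q → graph-functional g (to e (p , refl)) (q , refl)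
    }

-- Partial permutation matrices and the partial injections they encode.

record IsSubpermutation {n m : ℕ} (S : Matrix n m) : Set where
  field
    zero-one  : ∀ i j → ZeroOne (S i j)
    row-sum≤1 : ∀ i → sum (S i) ≤ 1
    col-sum≤1 : ∀ j → sum (transpose S j) ≤ 1

module _ {n m : ℕ} (S : Matrix n m)
         (row-unique : ∀ {i} → AtMostOne (λ j → S i j ≡ 1))
         (col-unique : ∀ {j} → AtMostOne (λ i → S i j ≡ 1)) where

  private
    hasOne? : Decidable (λ i → ∃ λ j → S i j ≡ 1)
    hasOne? i = any? λ j → S i j ℕ.≟ 1

    value : ∀ {i} → i ∈ comprehension hasOne? → ∃ λ j → S i j ≡ 1
    value = to (∈-comprehension hasOne?)

  -- A row belongs to the domain when it contains a one, and its value is the column that the search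
  -- `any?` returns.
  fromOnes : PartialInjection n m
  fromOnes = record
    { domain    = comprehension hasOne?
    ; injection = mk↣ {to = λ (i , i∈) → proj₁ (value i∈)} injective
    }
    where
    injective : ∀ {p q : ∃ λ i → i ∈ comprehension hasOne?} →
                proj₁ (value (proj₂ p)) ≡ proj₁ (value (proj₂ q)) → p ≡ q
    injective {i , p} {i′ , q} eq
      -- Both rows have a one in the common column, so they coincide; only the membership proofs
      -- remain to be identified.
      with refl ← col-unique (proj₂ (value p))
                    (trans (cong (S i′) eq) (proj₂ (value q)))
      = cong (i ,_) ([]=-irrelevant p q)

  -- The search may return any column holding a one; `row-unique` makes it the prescribed one.
  graph-fromOnes : ∀ {i j} → Graph fromOnes i j ⇔ S i j ≡ 1
  graph-fromOnes {i} {j} = mk⇔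
    (λ (i∈ , i↦j) → trans (cong (S i) (sym i↦j)) (proj₂ (value i∈)))
    (λ one → let i∈ = from (∈-comprehension hasOne?) (j , one)
             in i∈ , row-unique (proj₂ (value i∈)) one)

module _ {n m : ℕ} (f : PartialInjection n m) where

  graphMatrix : Matrix n m
  graphMatrix i j = indicator (graph? f i j)

  graphMatrix≡1 : ∀ {i j} → graphMatrix i j ≡ 1 ⇔ Graph f i j
  graphMatrix≡1 = indicator≡1 (graph? f _ _)

  graphMatrix-isSubpermutation : IsSubpermutation graphMatrix
  graphMatrix-isSubpermutation = record
    { zero-one  = zero-one
    ; row-sum≤1 = λ i → atMostOne⇒sum≤1 _ (zero-one i)
        λ p q → graph-functional f (to graphMatrix≡1 p) (to graphMatrix≡1 q)
    ; col-sum≤1 = λ j → atMostOne⇒sum≤1 _ (λ i → zero-one i j)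
        λ p q → graph-injective f (to graphMatrix≡1 p) (to graphMatrix≡1 q)
    }
    where
    zero-one : ∀ i j → ZeroOne (graphMatrix i j)
    zero-one i j = indicator-zeroOne (graph? f i j)

-- Diagonal matrices and the completion to a permutation matrix.

diagonal : ∀ {k} → Vector ℕ k → Matrix k k
diagonal v i j with i ≟ j
... | yes _ = v i
... | no  _ = 0

diagonal-diag : ∀ {k} (v : Vector ℕ k) i → diagonal v i i ≡ v i
diagonal-diag v i with i ≟ i
... | yes _  = refl
... | no i≢i = contradiction refl i≢i

diagonal-off : ∀ {k} (v : Vector ℕ k) → OffDiagonalZero (diagonal v)
diagonal-off v i j i≢j with i ≟ j
... | yes i≡j = contradiction i≡j i≢j
... | no  _   = refl

offDiagonalZero-≋ : ∀ {k} {D E : Matrix k k} → OffDiagonalZero D →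
                    OffDiagonalZero E → (∀ i → D i i ≡ E i i) → D ≋ E
offDiagonalZero-≋ D₀ E₀ diag i j with i ≟ j
... | yes refl = diag i
... | no  i≢j  = trans (D₀ i j i≢j) (sym (E₀ i j i≢j))

transpose-off : ∀ {k} {D : Matrix k k} → OffDiagonalZero D →
                OffDiagonalZero (transpose D)
transpose-off D₀ i j i≢j = D₀ j i (≢-sym i≢j)

diagonal-zeroOne : ∀ {k} (v : Vector ℕ k) → (∀ i → ZeroOne (v i)) →
                   ∀ i j → ZeroOne (diagonal v i j)
diagonal-zeroOne v v01 i j with i ≟ j
... | yes _ = v01 i
... | no  _ = inj₁ refl

module _ {n m : ℕ} (S : Matrix n m) where

  -- Truncated subtraction keeps this in {0,1} for every `S`; it completes the row sum to 1 once
  -- that sum is at most 1.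
  deficit : Vector ℕ n
  deficit i = 1 ∸ sum (S i)

  deficit-zeroOne : ∀ i → ZeroOne (deficit i)
  deficit-zeroOne i = ℕ.n≤1⇒n≡0∨n≡1 (ℕ.m∸n≤m 1 (sum (S i)))

-- Indexing by sum types turns block arguments into case analysis; `splitAt` then transfers them to
-- `Fin (n + m)`.
entry : ∀ {n m} → Matrix n m → Fin n ⊎ Fin m → Fin m ⊎ Fin n → ℕ
entry S (inj₁ i) (inj₁ j) = S i j
entry S (inj₁ i) (inj₂ k) = diagonal (deficit S) i k
entry S (inj₂ l) (inj₁ j) = diagonal (deficit (transpose S)) l j
entry S (inj₂ l) (inj₂ k) = S k l

completion : ∀ {n m} → Matrix n m → Matrix (n + m) (m + n)
completion {n} {m} S i j = entry S (splitAt n i) (splitAt m j)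

-- Completion commutes with transposition, because the two deficit blocks trade places and diagonal
-- matrices are symmetric. Column sums thereby reduce to row sums.
entry-transpose : ∀ {n m} (S : Matrix n m) x y →
                  entry S x y ≡ entry (transpose S) y x
entry-transpose S (inj₁ i) (inj₁ j) = refl
entry-transpose S (inj₁ i) (inj₂ k) =
  offDiagonalZero-≋ (diagonal-off _) (transpose-off (diagonal-off _))
    (λ _ → refl) i k
entry-transpose S (inj₂ l) (inj₁ j) =
  offDiagonalZero-≋ (diagonal-off _) (transpose-off (diagonal-off _))
    (λ _ → refl) l j
entry-transpose S (inj₂ l) (inj₂ k) = refl

sum-splitAt : ∀ m {n} (g : Fin m ⊎ Fin n → ℕ) →
              sum (g ∘ splitAt m) ≡ sum (g ∘ inj₁) + sum (g ∘ inj₂)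
sum-splitAt m {n} g = trans (sum-++ m (g ∘ splitAt m)) (cong₂ _+_
  (sum-cong-≗ λ i → cong g (splitAt-↑ˡ m i n))
  (sum-cong-≗ λ j → cong g (splitAt-↑ʳ m n j)))

sum-diagonal : ∀ {k} (v : Vector ℕ k) i → sum (diagonal v i) ≡ v i
sum-diagonal v i = trans (sum-single _ i (diagonal-off v i)) (diagonal-diag v i)

-- In the upper rows the deficit fills up a row of `S`. In the lower rows it fills up a column of
-- `S`, which is a row of the transpose placed in the `eps` block.
entry-row-sum : ∀ {n m} {S : Matrix n m} → IsSubpermutation S → ∀ x →
                sum (entry S x ∘ inj₁) + sum (entry S x ∘ inj₂) ≡ 1
entry-row-sum {S = S} isSub (inj₁ i) = trans
  (cong (sum (S i) +_) (sum-diagonal (deficit S) i))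
  (ℕ.m+[n∸m]≡n (IsSubpermutation.row-sum≤1 isSub i))
entry-row-sum {S = S} isSub (inj₂ l) = trans
  (cong (_+ sum (transpose S l)) (sum-diagonal (deficit (transpose S)) l))
  (ℕ.m∸n+n≡m (IsSubpermutation.col-sum≤1 isSub l))

completion-row-sum : ∀ {n m} {S : Matrix n m} → IsSubpermutation S →
                     ∀ i → sum (completion S i) ≡ 1
completion-row-sum {n} {m} {S} isSub i =
  trans (sum-splitAt m (entry S (splitAt n i))) (entry-row-sum isSub (splitAt n i))

transpose-isSubpermutation : ∀ {n m} {S : Matrix n m} →
                             IsSubpermutation S → IsSubpermutation (transpose S)
transpose-isSubpermutation isSub = record
  { zero-one  = λ j i → zero-one i j
  ; row-sum≤1 = col-sum≤1
  ; col-sum≤1 = row-sum≤1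
  }
  where open IsSubpermutation isSub

completion-isPermutation : ∀ {n m} {S : Matrix n m} → IsSubpermutation S →
                           IsPermutationMatrix (completion S)
completion-isPermutation {n} {m} {S} isSub = record
  { zero-one = λ i j → entry-zeroOne (splitAt n i) (splitAt m j)
  ; row-sum  = completion-row-sum isSub
  ; col-sum  = λ j → trans
      (sum-cong-≗ λ i → entry-transpose S (splitAt n i) (splitAt m j))
      (completion-row-sum (transpose-isSubpermutation isSub) j)
  }
  where
  open IsSubpermutation isSub
  entry-zeroOne : ∀ x y → ZeroOne (entry S x y)
  entry-zeroOne (inj₁ i) (inj₁ j) = zero-one i j
  entry-zeroOne (inj₁ i) (inj₂ k) = diagonal-zeroOne _ (deficit-zeroOne S) i k
  entry-zeroOne (inj₂ l) (inj₁ j) =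
    diagonal-zeroOne _ (deficit-zeroOne (transpose S)) l j
  entry-zeroOne (inj₂ l) (inj₂ k) = zero-one k l

completionMatrix : ∀ {n m} {S : Matrix n m} →
                   IsSubpermutation S → εAssignmentMatrix n m
completionMatrix {n} {m} {S} isSub = record
  { matrix        = completion S
  ; isPermutation = completion-isPermutation isSub
  ; rem-diagonal  = λ i k i≢k → trans
      (cong₂ (entry S) (splitAt-↑ˡ n i m) (splitAt-↑ʳ m n k))
      (diagonal-off _ i k i≢k)
  ; ins-diagonal  = λ l j l≢j → trans
      (cong₂ (entry S) (splitAt-↑ʳ n m l) (splitAt-↑ˡ m j n))
      (diagonal-off _ l j l≢j)
  }

sub-completion : ∀ {n m} (S : Matrix n m) → Blocks.sub {n} {m} (completion S) ≋ S
sub-completion {n} {m} S i j =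
  cong₂ (entry S) (splitAt-↑ˡ n i m) (splitAt-↑ˡ m j n)

-- From an assignment matrix to its partial injection.

module _ {n m : ℕ} (X : εAssignmentMatrix n m) where
  open εAssignmentMatrix X
  open IsPermutationMatrix isPermutation

  -- A full row sums to 1, and its part in `rem` reduces to the diagonal entry.
  sub-row+rem : ∀ i → sum (sub i) + rem i i ≡ 1
  sub-row+rem i = begin
    sum (sub i) + rem i i        ≡⟨ cong (sum (sub i) +_) (sum-single (rem i) i (rem-diagonal i)) ⟨
    sum (sub i) + sum (rem i)    ≡⟨ sum-++ m (matrix (i ↑ˡ m)) ⟨
    sum (matrix (i ↑ˡ m))        ≡⟨ row-sum (i ↑ˡ m) ⟩
    1                            ∎
    where open ≡-Reasoning

  sub-col+ins : ∀ j → sum (transpose sub j) + ins j j ≡ 1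
  sub-col+ins j = begin
    sum (transpose sub j) + ins j j               ≡⟨ cong (sum (transpose sub j) +_) (sum-single (transpose ins j) j (transpose-off ins-diagonal j)) ⟨
    sum (transpose sub j) + sum (transpose ins j) ≡⟨ sum-++ n (transpose matrix (j ↑ˡ n)) ⟨
    sum (transpose matrix (j ↑ˡ n))               ≡⟨ col-sum (j ↑ˡ n) ⟩
    1                                             ∎
    where open ≡-Reasoning

  sub-isSubpermutation : IsSubpermutation sub
  sub-isSubpermutation = record
    { zero-one  = λ i j → zero-one (i ↑ˡ m) (j ↑ˡ n)
    ; row-sum≤1 = λ i → ℕ.m+n≤o⇒m≤o _ (ℕ.≤-reflexive (sub-row+rem i))
    ; col-sum≤1 = λ j → ℕ.m+n≤o⇒m≤o _ (ℕ.≤-reflexive (sub-col+ins j))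
    }

  open IsSubpermutation sub-isSubpermutation using (row-sum≤1; col-sum≤1)

  private
    row-unique : ∀ {i} → AtMostOne (λ j → sub i j ≡ 1)
    row-unique {i} = sum≤1⇒atMostOne (sub i) (row-sum≤1 i)

    col-unique : ∀ {j} → AtMostOne (λ i → sub i j ≡ 1)
    col-unique {j} = sum≤1⇒atMostOne (transpose sub j) (col-sum≤1 j)

  substitution : PartialInjection n m
  substitution = fromOnes sub row-unique col-unique

  graph-substitution : ∀ {i j} → Graph substitution i j ⇔ sub i j ≡ 1
  graph-substitution = graph-fromOnes sub row-unique col-unique

-- Equivalence classes and the bijection.

module _ {n m : ℕ} {X Y : εAssignmentMatrix n m} where
  private
    module X = εAssignmentMatrix X
    module Y = εAssignmentMatrix Y

  sub-≋⇒∼ : X.sub ≋ Y.sub → X ∼ Y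
  sub-≋⇒∼ sub-≋ = record
    { sub-≋ = sub-≋
    ; rem-≋ = offDiagonalZero-≋ X.rem-diagonal Y.rem-diagonal λ i →
        -- Both diagonal entries complete the same row sum to 1, so cancelling that sum equates
        -- them.
        ℕ.+-cancelˡ-≡ (sum (X.sub i)) _ _ (trans (sub-row+rem X i) (trans
          (sym (sub-row+rem Y i))
          (cong (_+ Y.rem i i) (sum-cong-≗ λ j → sym (sub-≋ i j)))))
    ; ins-≋ = offDiagonalZero-≋ X.ins-diagonal Y.ins-diagonal λ j →
        ℕ.+-cancelˡ-≡ (sum (transpose X.sub j)) _ _ (trans (sub-col+ins X j) (trans
          (sym (sub-col+ins Y j))
          (cong (_+ Y.ins j j) (sum-cong-≗ λ i → sym (sub-≋ i j)))))
    }

  substitution-cong : X ∼ Y → substitution X ≐ substitution Y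
  substitution-cong X∼Y = graph⇒≐ λ {i} {j} → mk⇔
    (λ g → from (graph-substitution Y)
      (trans (sym (sub-≋ i j)) (to (graph-substitution X) g)))
    (λ g → from (graph-substitution X)
      (trans (sub-≋ i j) (to (graph-substitution Y) g)))
    where open _∼_ X∼Y

  -- Equal functions have equal graphs, so the two `sub` blocks have their ones in the same places.
  substitution-injective : substitution X ≐ substitution Y → X ∼ Y
  substitution-injective e = sub-≋⇒∼ λ i j → zeroOne-≡
    (IsSubpermutation.zero-one (sub-isSubpermutation X) i j)
    (IsSubpermutation.zero-one (sub-isSubpermutation Y) i j)
    (mk⇔
      (to (graph-substitution Y) ∘ ≐⇒graph e ∘ from (graph-substitution X))
      (to (graph-substitution X) ∘ ≐⇒graph (≐-sym e) ∘ from (graph-substitution Y)))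

module _ {n m : ℕ} (f : PartialInjection n m) where

  fromPartialInjection : εAssignmentMatrix n m
  fromPartialInjection = completionMatrix (graphMatrix-isSubpermutation f)

  substitution-fromPartialInjection : substitution fromPartialInjection ≐ f
  substitution-fromPartialInjection = graph⇒≐ λ {i} {j} → mk⇔
    (λ g → to (graphMatrix≡1 f)
      (trans (sym (sub-completion (graphMatrix f) i j))
             (to (graph-substitution fromPartialInjection) g)))
    (λ g → from (graph-substitution fromPartialInjection)
      (trans (sub-completion (graphMatrix f) i j) (from (graphMatrix≡1 f) g)))

proposition6 : ∀ (n m : ℕ) → Bijection (𝒜∼ n m) (PartialInjections n m)
proposition6 n m = record
  { to        = substitution
  ; cong      = substitution-cong
  ; bijective = substitution-injective , λ f → fromPartialInjection f ,
      -- Surjectivity of setoid maps concerns every matrix equivalent to the chosen preimage, hence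
      -- congruence comes first.
      λ X∼ → ≐-trans (substitution-cong X∼) (substitution-fromPartialInjection f)
  }
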